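{- Let $r$ be a nonnegative integer. There exist rational numbers $b_\nu=b_\nu(r)$, indexed by integer partitions $\nu$ with $|\nu|\le 2r+2$ and independent of $\lambda$, such that $$S(\lambda,r)=\sum_{|\nu|\le 2r+2}b_\nu q_\nu(\lambda)$$ for every partition $\lambda$.
   Context: $h_\square$ is the hook length of a box (arm + leg + 1) and $S(\lambda,r)=\sum_{\square\in\lambda}\prod_{1\le j\le r}(h_\square^2-j^2)$. Boxes are indexed $(i,j)$ with row $i$, column $j$. For a partition $\lambda$, let $(\alpha_1,\beta_1),\ldots,(\alpha_m,\beta_m)$ be the coordinates of its removable boxes, ordered with $\alpha_1>\cdots>\alpha_m$; set $\alpha_{m+1}=\beta_0=0$, $x_i=\beta_i-\alpha_{i+1}$ ($0\le i\le m$), $y_j=\beta_j-\alpha_j$ ($1\le j\le m$), and $q_k(\lambda)=\sum_{i=0}^mx_i^k-\sum_{j=1}^my_j^k$. For $\nu=(\nu_1,\ldots,\nu_\ell)$, $q_\nu=q_{\nu_1}\cdots q_{\nu_\ell}$, with $q_\emptyset=1$. -}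

module Defs where

open import Data.Nat as ℕ using (ℕ; zero; suc; _<_; _≥_; _≤_; _≤ᵇ_)
open import Data.Integer as ℤ using (ℤ; +_; _-_; _*_; _^_)
open import Data.List using (List; []; _∷_; length; map; zipWith; reverse; _++_; foldr)
open import Data.List.Relation.Unary.All using (All)
open import Data.List.Relation.Unary.Linked using (Linked)
open import Data.Bool using (if_then_else_)
open import Data.Product using (_×_; _,_; proj₁; proj₂)

IsPartition : List ℕ → Set
IsPartition λ' = All (λ n → 0 < n) λ' × Linked _≥_ λ'

size : List ℕ → ℕ
size = foldr ℕ._+_ 0

range1 : ℕ → List ℕ
range1 zero = []
range1 (suc n) = range1 n ++ (suc n ∷ [])

-- λ_i (1-indexed, 0 outside)
part : List ℕ → ℕ → ℕ
part [] _ = 0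
part (x ∷ xs) zero = 0
part (x ∷ xs) (suc zero) = x
part (x ∷ xs) (suc (suc i)) = part xs (suc i)

conj : List ℕ → ℕ → ℕ
conj λ' j = length (Data.List.filter (λ n → j ℕ.≤? n) λ')

hook : List ℕ → ℕ → ℕ → ℤ
hook λ' i j = (+ part λ' i - + j) ℤ.+ (+ conj λ' j - + i) ℤ.+ + 1

boxes : List ℕ → List (ℕ × ℕ)
boxes λ' = Data.List.concatMap (λ i → map (λ j → (i , j)) (range1 (part λ' i))) (range1 (length λ'))

sumℤ : List ℤ → ℤ
sumℤ = foldr ℤ._+_ (+ 0)

prodℤ : List ℤ → ℤ
prodℤ = foldr ℤ._*_ (+ 1)

S : List ℕ → ℕ → ℤ
S λ' r = sumℤ (map (λ b → prodℤ (map (λ j → hook λ' (proj₁ b) (proj₂ b) ^ 2 - (+ j) ^ 2) (range1 r))) (boxes λ'))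

-- removable boxes (α , β) = (i , λ_i) with i = ℓ or λ_i > λ_{i+1},
-- listed with α decreasing (α₁ > ... > α_m)
removable : List ℕ → List (ℕ × ℕ)
removable λ' = reverse (Data.List.concatMap
  (λ i → if suc (part λ' (suc i)) ≤ᵇ part λ' i then (i , part λ' i) ∷ [] else []) (range1 (length λ')))

-- x_0, ..., x_m with x_i = β_i - α_{i+1}, β_0 = α_{m+1} = 0
xs : List ℕ → List ℤ
xs λ' = zipWith (λ b a → + b - + a) (0 ∷ map proj₂ (removable λ')) (map proj₁ (removable λ') ++ (0 ∷ []))

ys : List ℕ → List ℤ
ys λ' = map (λ p → + proj₂ p - + proj₁ p) (removable λ')

q : ℕ → List ℕ → ℤ
q k λ' = sumℤ (map (_^ k) (xs λ')) - sumℤ (map (_^ k) (ys λ'))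

qν : List ℕ → List ℕ → ℤ
qν ν λ' = prodℤ (map (λ k → q k λ') ν)

{-# OPTIONS --safe #-}

-- Write μ(g) = Σ g(xᵢ) - Σ g(yⱼ), so that q_k = μ(u ↦ uᵏ).  Putting a row of
-- length a on top of λ shifts all corners by -1 and adds g(a) - g(a - 1) to μ(g),
-- also when no new corner appears.  Let P be an even polynomial with P(0) = 0 and
-- P(n + 1) - 2P(n) + P(n - 1) = N f(n).  By induction on the rows,
-- 2N Σ f(h) = μ_u μ_v P(u - v), the sum being over all hook lengths h: the hooks of
-- the new row telescope.  Expanding P(u - v) in monomials uᵃ vᵇ turns the right
-- hand side into a combination of the q_a q_b with a + b ≤ deg P.  For
-- f(h) = ∏ (h² - j²) a suitable P of degree 2r + 2 comes from expanding f in the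
-- central factorials cf_k(n) = ∏_{j<k} (n² - j²), because
-- cf_{k+1}(n + 1) - 2 cf_{k+1}(n) + cf_{k+1}(n - 1) = (2k + 2)(2k + 1) cf_k(n).
module Submission where

open import Defs

-- Corner sums and total hook sums, by recursion on rows

module CornerSums where

  open import Data.Nat as ℕ using (ℕ; zero; suc; _≤_; _<_; _≥_; s≤s)
  import Data.Nat.Properties as ℕ
  open import Data.Integer using (ℤ; +_; -_; _+_; _-_; _*_)
  open import Data.Integer.Properties using (+-assoc; +-identityˡ; *-zeroʳ; *-distribˡ-+)
  open import Data.Integer.Tactic.RingSolver using (solve-∀)
  open import Data.List using (List; []; _∷_; length; applyUpTo)
  open import Data.List.Properties
    using (filter-accept; filter-reject)
  open import Data.List.Relation.Unary.Linked as Linked using (Linked; []; [-]; _∷_)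
  open import Function using (_∘_)
  open import Relation.Binary.PropositionalEquality
  open ≡-Reasoning

  -- This is `μ`. The empty partition has the single value x₀ = 0; a top corner in row 1 and column
  -- `a` brings the x-value `a` and the y-value `a - 1`. The recursion refers to rows only, so no
  -- case distinction on corners enters before the comparison with `removable`.
  cornerSum : List ℕ → (ℤ → ℤ) → ℤ
  cornerSum [] g = g (+ 0)
  cornerSum (a ∷ lam) g = cornerSum lam (λ u → g (u - + 1)) - g (+ a - + 1) + g (+ a)

  cornerSum-cong : ∀ lam {g h : ℤ → ℤ} → (∀ u → g u ≡ h u) → cornerSum lam g ≡ cornerSum lam h
  cornerSum-cong [] g≗h = g≗h (+ 0)
  cornerSum-cong (a ∷ lam) g≗h =
    cong₂ _+_ (cong₂ _-_ (cornerSum-cong lam (λ u → g≗h (u - + 1))) (g≗h (+ a - + 1))) (g≗h (+ a))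

  -- There is one more x than there are y's. For `c = 1` this says that q₀ is 1, which later allows
  -- exponents 0 to be dropped.
  cornerSum-const : ∀ lam c → cornerSum lam (λ _ → c) ≡ c
  cornerSum-const [] c = refl
  cornerSum-const (a ∷ lam) c = trans (cong (λ s → s - c + c) (cornerSum-const lam c)) (cancel c)
    where
    cancel : ∀ c → c - c + c ≡ c
    cancel = solve-∀

  cornerSum-+ : ∀ lam g h → cornerSum lam (λ u → g u + h u) ≡ cornerSum lam g + cornerSum lam h
  cornerSum-+ [] g h = refl
  cornerSum-+ (a ∷ lam) g h =
    trans (cong (λ s → s - _ + _) (cornerSum-+ lam (λ u → g (u - + 1)) (λ u → h (u - + 1))))
          (rearrange (cornerSum lam (λ u → g (u - + 1))) (cornerSum lam (λ u → h (u - + 1)))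
                     (g (+ a - + 1)) (h (+ a - + 1)) (g (+ a)) (h (+ a)))
    where
    rearrange : ∀ s t x y z w → s + t - (x + y) + (z + w) ≡ (s - x + z) + (t - y + w)
    rearrange = solve-∀

  cornerSum-* : ∀ lam c g → cornerSum lam (λ u → c * g u) ≡ c * cornerSum lam g
  cornerSum-* [] c g = refl
  cornerSum-* (a ∷ lam) c g =
    trans (cong (λ s → s - _ + _) (cornerSum-* lam c (λ u → g (u - + 1)))) (factor c _ _ _)
    where
    factor : ∀ c s x y → c * s - c * x + c * y ≡ c * (s - x + y)
    factor = solve-∀

  cornerSum-- : ∀ lam g h → cornerSum lam (λ u → g u - h u) ≡ cornerSum lam g - cornerSum lam h
  cornerSum-- lam g h = begin
    cornerSum lam (λ u → g u - h u)
      ≡⟨ cornerSum-cong lam (λ u → expand (g u) (h u)) ⟩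
    cornerSum lam (λ u → g u + - + 1 * h u)
      ≡⟨ cornerSum-+ lam g (λ u → - + 1 * h u) ⟩
    cornerSum lam g + cornerSum lam (λ u → - + 1 * h u)
      ≡⟨ cong (_+_ (cornerSum lam g)) (cornerSum-* lam (- + 1) h) ⟩
    cornerSum lam g + - + 1 * cornerSum lam h
      ≡⟨ expand (cornerSum lam g) (cornerSum lam h) ⟨
    cornerSum lam g - cornerSum lam h ∎
    where
    expand : ∀ x y → x - y ≡ x + - + 1 * y
    expand = solve-∀

  Linked-head : ∀ {a lam} → Linked _≥_ (a ∷ lam) → part lam 1 ≤ a
  Linked-head [-] = ℕ.z≤n
  Linked-head (a≥b ∷ _) = a≥b

  part-≤ : ∀ {a lam} → Linked _≥_ (a ∷ lam) → ∀ i → part lam (suc i) ≤ a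
  part-≤ l zero = Linked-head l
  part-≤ [-] (suc i) = ℕ.z≤n
  part-≤ (a≥b ∷ l) (suc i) = ℕ.≤-trans (part-≤ l i) a≥b

  conj-∷ : ∀ {a j} lam → j ≤ a → conj (a ∷ lam) j ≡ suc (conj lam j)
  conj-∷ {j = j} lam j≤a = cong length (filter-accept (j ℕ.≤?_) {xs = lam} j≤a)

  conj-zero : ∀ {lam j} → Linked _≥_ lam → part lam 1 < j → conj lam j ≡ 0
  conj-zero {[]} _ _ = refl
  conj-zero {a ∷ lam} {j} l a<j =
    trans (cong length (filter-reject (j ℕ.≤?_) {xs = lam} (ℕ.<⇒≱ a<j)))
          (conj-zero (Linked.tail l) (ℕ.≤-<-trans (Linked-head l) a<j))

  applyUpTo-cong : ∀ {A : Set} {f g : ℕ → A} n → (∀ i → i < n → f i ≡ g i) →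
                   applyUpTo f n ≡ applyUpTo g n
  applyUpTo-cong zero _ = refl
  applyUpTo-cong (suc n) f≗g =
    cong₂ _∷_ (f≗g 0 (s≤s ℕ.z≤n)) (applyUpTo-cong n (λ i i<n → f≗g (suc i) (s≤s i<n)))

  -- Hooks of a new top row

  sumTo : ℕ → (ℕ → ℤ) → ℤ
  sumTo n f = sumℤ (applyUpTo f n)

  sumTo-cong : ∀ n {f g : ℕ → ℤ} → (∀ i → i < n → f i ≡ g i) → sumTo n f ≡ sumTo n g
  sumTo-cong n f≗g = cong sumℤ (applyUpTo-cong n f≗g)

  sumTo-split : ∀ m n f → sumTo (m ℕ.+ n) f ≡ sumTo m f + sumTo n (λ i → f (m ℕ.+ i))
  sumTo-split zero n f = sym (+-identityˡ _)
  sumTo-split (suc m) n f =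
    trans (cong (_+_ (f 0)) (sumTo-split m n (f ∘ suc))) (sym (+-assoc (f 0) (sumTo m (f ∘ suc)) _))

  -- The hook length of box j + 1 of a row of length a placed on top of lam.
  rowHook : ℕ → List ℕ → ℕ → ℤ
  rowHook a lam j = + a - + suc j + + conj lam (suc j) + + 1

  rowSum : (ℤ → ℤ) → ℕ → List ℕ → ℤ
  rowSum f a lam = sumTo a (λ j → f (rowHook a lam j))

  hookSum : (ℤ → ℤ) → List ℕ → ℤ
  hookSum f [] = + 0
  hookSum f (a ∷ lam) = rowSum f a lam + hookSum f lam

  -- Beyond column `b` nothing lies below the row, so the legs vanish there and the hooks are `d`,
  -- ..., 1.
  rowSum-split : ∀ f {b lam} d → Linked _≥_ lam → part lam 1 ≤ b →
    rowSum f (b ℕ.+ d) lam ≡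
      sumTo b (λ j → f (rowHook (b ℕ.+ d) lam j)) + sumTo d (λ j → f (+ d - + j))
  rowSum-split f {b} {lam} d l lam₁≤b =
    trans (sumTo-split b d _)
          (cong (_+_ (sumTo b (λ j → f (rowHook (b ℕ.+ d) lam j))))
                (sumTo-cong d (λ j _ → cong f (tail-hook j))))
    where
    simplify : ∀ b d j → b + d - (+ 1 + (b + j)) + + 0 + + 1 ≡ d - j
    simplify = solve-∀
    tail-hook : ∀ j → rowHook (b ℕ.+ d) lam (b ℕ.+ j) ≡ + d - + j
    tail-hook j =
      trans (cong (λ c → + (b ℕ.+ d) - + suc (b ℕ.+ j) + + c + + 1)
                  (conj-zero l (s≤s (ℕ.≤-trans lam₁≤b (ℕ.m≤m+n b j)))))
            (simplify (+ b) (+ d) (+ j))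

  module _ (N : ℤ) (f G : ℤ → ℤ) (ΔG : ∀ n → N * f n ≡ G n - G (n - + 1)) where

    telescope : ∀ d → N * sumTo d (λ j → f (+ d - + j)) ≡ G (+ d) - G (+ 0)
    telescope zero = lemma N (G (+ 0))
      where
      lemma : ∀ N x → N * + 0 ≡ x - x
      lemma = solve-∀
    telescope (suc d) = begin
      N * (f (+ suc d - + 0) + sumTo d (λ j → f (+ suc d - + suc j)))
        ≡⟨ cong₂ (λ x y → N * (x + y)) (cong f (minus-0 (+ suc d)))
                 (sumTo-cong d (λ j _ → cong f (cancel (+ d) (+ j)))) ⟩
      N * (f (+ suc d) + sumTo d (λ j → f (+ d - + j)))
        ≡⟨ *-distribˡ-+ N _ _ ⟩
      N * f (+ suc d) + N * sumTo d (λ j → f (+ d - + j))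
        ≡⟨ cong₂ _+_ (ΔG (+ suc d)) (telescope d) ⟩
      G (+ suc d) - G (+ suc d - + 1) + (G (+ d) - G (+ 0))
        ≡⟨ cong (λ x → G (+ suc d) - G x + (G (+ d) - G (+ 0))) (pred-suc (+ d)) ⟩
      G (+ suc d) - G (+ d) + (G (+ d) - G (+ 0))
        ≡⟨ chain (G (+ suc d)) (G (+ d)) (G (+ 0)) ⟩
      G (+ suc d) - G (+ 0) ∎
      where
      minus-0 : ∀ x → x - + 0 ≡ x
      minus-0 = solve-∀
      cancel : ∀ x y → (+ 1 + x) - (+ 1 + y) ≡ x - y
      cancel = solve-∀
      pred-suc : ∀ x → + 1 + x - + 1 ≡ x
      pred-suc = solve-∀
      chain : ∀ x y z → x - y + (y - z) ≡ x - z
      chain = solve-∀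

    -- Induction on `lam` with `a` arbitrary: deleting the row `b` just below is compensated by
    -- lengthening the top row by one box, so the induction hypothesis is applied to a longer row.
    -- Only the overhang of the top row beyond `b` is telescoped directly.
    rowSum-cornerSum : ∀ {lam} a → Linked _≥_ lam → part lam 1 ≤ a →
      N * rowSum f a lam ≡ cornerSum lam (λ u → G (+ a - u)) - G (+ 0)
    rowSum-cornerSum {[]} a l _ = begin
      N * rowSum f a []
        ≡⟨ cong (N *_) (sumTo-cong a (λ j _ → cong f (simplify (+ a) (+ j)))) ⟩
      N * sumTo a (λ j → f (+ a - + j))
        ≡⟨ telescope a ⟩
      G (+ a) - G (+ 0)
        ≡⟨ cong (λ x → G x - G (+ 0)) (minus-0 (+ a)) ⟩
      G (+ a - + 0) - G (+ 0) ∎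
      where
      simplify : ∀ a j → a - (+ 1 + j) + + 0 + + 1 ≡ a - j
      simplify = solve-∀
      minus-0 : ∀ x → x ≡ x - + 0
      minus-0 = solve-∀
    rowSum-cornerSum {b ∷ lam} a l b≤a =
      subst (λ a → N * rowSum f a (b ∷ lam) ≡ cornerSum (b ∷ lam) (λ u → G (+ a - u)) - G (+ 0))
            (ℕ.m+[n∸m]≡n b≤a) (extended (a ℕ.∸ b))
      where
      -- Lengthening the row by one and deleting the row b below it preserves
      -- the first b hooks.
      same-hooks : ∀ d j → j < b → rowHook (b ℕ.+ suc d) lam j ≡ rowHook (b ℕ.+ d) (b ∷ lam) j
      same-hooks d j j<b =
        trans (shift (+ b) (+ d) (+ j) (+ conj lam (suc j)))
              (cong (λ c → + (b ℕ.+ d) - + suc j + + c + + 1) (sym (conj-∷ lam j<b)))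
        where
        shift : ∀ b d j c → b + (+ 1 + d) - (+ 1 + j) + c + + 1 ≡ b + d - (+ 1 + j) + (+ 1 + c) + + 1
        shift = solve-∀

      extended : ∀ d → N * rowSum f (b ℕ.+ d) (b ∷ lam) ≡
                 cornerSum (b ∷ lam) (λ u → G (+ (b ℕ.+ d) - u)) - G (+ 0)
      extended d = begin
        N * rowSum f (b ℕ.+ d) (b ∷ lam)
          ≡⟨ cong (N *_) (rowSum-split f d l ℕ.≤-refl) ⟩
        N * (first + sumTo d (λ j → f (+ d - + j)))
          ≡⟨ *-distribˡ-+ N _ _ ⟩
        N * first + N * sumTo d (λ j → f (+ d - + j))
          ≡⟨ cong (_+_ (N * first)) (telescope d) ⟩
        N * first + (G (+ d) - G (+ 0))
          -- In the lengthened row the overhang starts at `suc d`, so `G (+ suc d)` is inserted to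
          -- match `longer`. What is left, `- G (+ suc d) + G (+ d)`, is exactly the contribution of
          -- the row `b` to the corner sum.
          ≡⟨ insert (N * first) (G (+ suc d)) (G (+ d)) (G (+ 0)) ⟩
        N * first + (G (+ suc d) - G (+ 0)) - G (+ suc d) + G (+ d)
          ≡⟨ cong (λ s → s - G (+ suc d) + G (+ d)) longer ⟩
        C - G (+ 0) - G (+ suc d) + G (+ d)
          ≡⟨ regroup C (G (+ 0)) (G (+ suc d)) (G (+ d)) ⟩
        C - G (+ suc d) + G (+ d) - G (+ 0)
          ≡⟨ cong (_- G (+ 0))
               (cong₂ _+_ (cong₂ _-_ (cornerSum-cong lam (λ u → cong G (arg₁ (+ b) (+ d) u)))
                                     (cong G (arg₂ (+ b) (+ d))))
                          (cong G (arg₃ (+ b) (+ d)))) ⟩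
        cornerSum (b ∷ lam) (λ u → G (+ (b ℕ.+ d) - u)) - G (+ 0) ∎
        where
        first C : ℤ
        first = sumTo b (λ j → f (rowHook (b ℕ.+ d) (b ∷ lam) j))
        C = cornerSum lam (λ u → G (+ (b ℕ.+ suc d) - u))
        longer : N * first + (G (+ suc d) - G (+ 0)) ≡ C - G (+ 0)
        longer = begin
          N * first + (G (+ suc d) - G (+ 0))
            ≡⟨ cong (_+_ (N * first)) (telescope (suc d)) ⟨
          N * first + N * sumTo (suc d) (λ j → f (+ suc d - + j))
            ≡⟨ *-distribˡ-+ N _ _ ⟨
          N * (first + sumTo (suc d) (λ j → f (+ suc d - + j)))
            ≡⟨ cong (λ s → N * (s + sumTo (suc d) (λ j → f (+ suc d - + j))))
                    (sumTo-cong b (λ j j<b → cong f (same-hooks d j j<b))) ⟨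
          N * (sumTo b (λ j → f (rowHook (b ℕ.+ suc d) lam j)) + sumTo (suc d) (λ j → f (+ suc d - + j)))
            ≡⟨ cong (N *_) (rowSum-split f (suc d) (Linked.tail l) (Linked-head l)) ⟨
          N * rowSum f (b ℕ.+ suc d) lam
            ≡⟨ rowSum-cornerSum (b ℕ.+ suc d) (Linked.tail l)
                 (ℕ.≤-trans (Linked-head l) (ℕ.m≤m+n b (suc d))) ⟩
          C - G (+ 0) ∎
        insert : ∀ x y z w → x + (z - w) ≡ x + (y - w) - y + z
        insert = solve-∀
        regroup : ∀ x y z w → x - y - z + w ≡ x - z + w - y
        regroup = solve-∀
        arg₁ : ∀ b d u → b + (+ 1 + d) - u ≡ b + d - (u - + 1)
        arg₁ = solve-∀
        arg₂ : ∀ b d → + 1 + d ≡ b + d - (b - + 1)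
        arg₂ = solve-∀
        arg₃ : ∀ b d → d ≡ b + d - b
        arg₃ = solve-∀

  -- The quadratic form of `μ` and the sum over all hooks

  pairing : (ℤ → ℤ) → List ℕ → ℤ
  pairing P lam = cornerSum lam (λ u → cornerSum lam (λ v → P (u - v)))

  module _ (N : ℤ) (f P : ℤ → ℤ) (P-zero : P (+ 0) ≡ + 0) (P-even : ∀ n → P (- n) ≡ P n)
           (Δ²P : ∀ n → P (n + + 1) + P (n - + 1) ≡ + 2 * P n + N * f n) where

    -- The new row turns `μ` into its shift plus a point mass at `a` minus one at `a - 1`. The shift
    -- does not affect differences `u - v`; the two mixed terms agree because `P` is even; the point
    -- masses paired with themselves give 2 P(0) - 2 P(1).
    pairing-∷ : ∀ a lam → pairing P (a ∷ lam) ≡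
      pairing P lam + + 2 * (cornerSum lam (λ u → P (+ a - u + + 1))
                             - cornerSum lam (λ u → P (+ a - u)) - P (+ 1))
    pairing-∷ a lam = begin
      cornerSum lam (λ u → h (u - + 1)) - h (+ a - + 1) + h (+ a)
        ≡⟨ cong₂ _+_ (cong₂ _-_ shifted at-pred) at-a ⟩
      pairing P lam - C₀ + C₁ - (C₀ - P (+ 0) + P (+ 1)) + (C₁ - P (+ 1) + P (+ 0))
        ≡⟨ cong (λ z → pairing P lam - C₀ + C₁ - (C₀ - z + P (+ 1)) + (C₁ - P (+ 1) + z)) P-zero ⟩
      pairing P lam - C₀ + C₁ - (C₀ - + 0 + P (+ 1)) + (C₁ - P (+ 1) + + 0)
        ≡⟨ collect (pairing P lam) C₀ C₁ (P (+ 1)) ⟩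
      pairing P lam + + 2 * (C₁ - C₀ - P (+ 1)) ∎
      where
      h : ℤ → ℤ
      h u = cornerSum (a ∷ lam) (λ v → P (u - v))
      C₀ C₁ : ℤ
      C₀ = cornerSum lam (λ u → P (+ a - u))
      C₁ = cornerSum lam (λ u → P (+ a - u + + 1))
      reflect : ∀ {m n} → m ≡ - n → P m ≡ P n
      reflect {n = n} m≡-n = trans (cong P m≡-n) (P-even n)
      e₁ : ∀ u v → u - + 1 - (v - + 1) ≡ u - v
      e₁ = solve-∀
      e₂ : ∀ u a → u - + 1 - (a - + 1) ≡ - (a - u)
      e₂ = solve-∀
      e₃ : ∀ u a → u - + 1 - a ≡ - (a - u + + 1)
      e₃ = solve-∀
      e₄ : ∀ a v → a - (v - + 1) ≡ a - v + + 1
      e₄ = solve-∀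
      e₅ : ∀ a → a - (a - + 1) ≡ + 1
      e₅ = solve-∀
      e₆ : ∀ a → a - a ≡ + 0
      e₆ = solve-∀
      e₇ : ∀ a → a - + 1 - a ≡ - + 1
      e₇ = solve-∀
      collect : ∀ q x y p → q - x + y - (x - + 0 + p) + (y - p + + 0) ≡ q + + 2 * (y - x - p)
      collect = solve-∀
      shifted : cornerSum lam (λ u → h (u - + 1)) ≡ pairing P lam - C₀ + C₁
      shifted = begin
        cornerSum lam (λ u → h (u - + 1))
          ≡⟨ cornerSum-cong lam (λ u → cong₂ _+_
               (cong₂ _-_ (cornerSum-cong lam (λ v → cong P (e₁ u v))) (reflect (e₂ u (+ a))))
               (reflect (e₃ u (+ a)))) ⟩
        cornerSum lam (λ u → cornerSum lam (λ v → P (u - v)) - P (+ a - u) + P (+ a - u + + 1))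
          ≡⟨ cornerSum-+ lam (λ u → cornerSum lam (λ v → P (u - v)) - P (+ a - u)) _ ⟩
        cornerSum lam (λ u → cornerSum lam (λ v → P (u - v)) - P (+ a - u)) + C₁
          ≡⟨ cong (_+ C₁) (cornerSum-- lam _ _) ⟩
        pairing P lam - C₀ + C₁ ∎
      at-a : h (+ a) ≡ C₁ - P (+ 1) + P (+ 0)
      at-a = cong₂ _+_ (cong₂ _-_ (cornerSum-cong lam (λ v → cong P (e₄ (+ a) v)))
                                  (cong P (e₅ (+ a))))
                       (cong P (e₆ (+ a)))
      at-pred : h (+ a - + 1) ≡ C₀ - P (+ 0) + P (+ 1)
      at-pred = cong₂ _+_ (cong₂ _-_ (cornerSum-cong lam (λ v → cong P (e₁ (+ a) v)))
                                     (cong P (e₆ (+ a - + 1))))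
                          (reflect (e₇ (+ a)))

    -- The second difference of `P` is the backward difference of `G`, the forward difference of
    -- `P`. Hence twice the contribution of the top row by `rowSum-cornerSum` is the increment found
    -- in `pairing-∷`, since `G (+ 0)` is P(1).
    hookSum-pairing : ∀ {lam} → Linked _≥_ lam → + 2 * N * hookSum f lam ≡ pairing P lam
    hookSum-pairing {[]} _ = trans (*-zeroʳ (+ 2 * N)) (sym P-zero)
    hookSum-pairing {a ∷ lam} l = begin
      + 2 * N * (rowSum f a lam + hookSum f lam)
        ≡⟨ distribute N (rowSum f a lam) (hookSum f lam) ⟩
      + 2 * N * hookSum f lam + + 2 * (N * rowSum f a lam)
        ≡⟨ cong₂ (λ x y → x + + 2 * y) (hookSum-pairing (Linked.tail l))
             (rowSum-cornerSum N f G ΔG a (Linked.tail l) (Linked-head l)) ⟩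
      pairing P lam + + 2 * (cornerSum lam (λ u → G (+ a - u)) - G (+ 0))
        ≡⟨ cong₂ (λ x y → pairing P lam + + 2 * (x - y)) (cornerSum-- lam _ _)
                 (trans (cong (_-_ (P (+ 1))) P-zero) (minus-0 _)) ⟩
      pairing P lam + + 2 * (cornerSum lam (λ u → P (+ a - u + + 1))
                             - cornerSum lam (λ u → P (+ a - u)) - P (+ 1))
        ≡⟨ pairing-∷ a lam ⟨
      pairing P (a ∷ lam) ∎
      where
      G : ℤ → ℤ
      G n = P (n + + 1) - P n
      minus-0 : ∀ x → x - + 0 ≡ x
      minus-0 = solve-∀
      distribute : ∀ N x y → + 2 * N * (x + y) ≡ + 2 * N * y + + 2 * (N * x)
      distribute = solve-∀
      pred-suc : ∀ n → n ≡ n - + 1 + + 1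
      pred-suc = solve-∀
      isolate : ∀ y z → y ≡ + 2 * z + y - + 2 * z
      isolate = solve-∀
      cancel : ∀ x y z → x + y - + 2 * z ≡ (x - z) - (z - y)
      cancel = solve-∀
      ΔG : ∀ n → N * f n ≡ G n - G (n - + 1)
      ΔG n = begin
        N * f n                                              ≡⟨ isolate (N * f n) (P n) ⟩
        + 2 * P n + N * f n - + 2 * P n                      ≡⟨ cong (λ s → s - + 2 * P n) (Δ²P n) ⟨
        P (n + + 1) + P (n - + 1) - + 2 * P n                ≡⟨ cancel (P (n + + 1)) (P (n - + 1)) (P n) ⟩
        P (n + + 1) - P n - (P n - P (n - + 1))
          ≡⟨ cong (λ m → P (n + + 1) - P n - (P m - P (n - + 1))) (pred-suc n) ⟩
        G n - G (n - + 1) ∎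

-- Comparison with the given definitions of `S` and `q`

module Corners where

  open import Data.Bool using (true; false; if_then_else_; T)
  open import Data.Bool.Properties using (if-float)
  open import Data.Nat as ℕ using (ℕ; zero; suc; _<_; _≥_; _≤ᵇ_)
  import Data.Nat.Properties as ℕ
  open import Data.Integer using (ℤ; +_; -_; _+_; _-_; _^_)
  open import Data.Integer.Properties using (+-assoc; +-identityˡ; +-identityʳ)
  open import Data.Integer.Tactic.RingSolver using (solve-∀)
  open import Data.List
    using (List; []; _∷_; _++_; concat; concatMap; length; map; reverse; zipWith; applyUpTo)
  open import Data.List.Properties
    using (++-identityʳ; applyUpTo-∷ʳ; map-applyUpTo; map-concatMap; reverse-++; reverse-map)
  open import Data.List.Relation.Unary.Linked as Linked using (Linked)
  open import Data.Product using (_×_; _,_; proj₁; proj₂)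
  open import Function using (_∘_)
  open import Relation.Binary.PropositionalEquality
  open ≡-Reasoning
  open CornerSums

  range1-applyUpTo : ∀ n → range1 n ≡ applyUpTo suc n
  range1-applyUpTo zero = refl
  range1-applyUpTo (suc n) =
    trans (cong (_++ suc n ∷ []) (range1-applyUpTo n)) (applyUpTo-∷ʳ suc n)

  map-range1 : ∀ {A : Set} (f : ℕ → A) n → map f (range1 n) ≡ applyUpTo (f ∘ suc) n
  map-range1 f n = trans (cong (map f) (range1-applyUpTo n)) (map-applyUpTo suc f n)

  sumℤ-++ : ∀ ks ls → sumℤ (ks ++ ls) ≡ sumℤ ks + sumℤ ls
  sumℤ-++ [] ls = sym (+-identityˡ _)
  sumℤ-++ (k ∷ ks) ls = trans (cong (_+_ k) (sumℤ-++ ks ls)) (sym (+-assoc k (sumℤ ks) (sumℤ ls)))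

  sumℤ-concatMap : ∀ {A : Set} (f : A → List ℤ) is →
                   sumℤ (concatMap f is) ≡ sumℤ (map (sumℤ ∘ f) is)
  sumℤ-concatMap f [] = refl
  sumℤ-concatMap f (i ∷ is) =
    trans (sumℤ-++ (f i) (concatMap f is)) (cong (_+_ (sumℤ (f i))) (sumℤ-concatMap f is))

  sum-boxes : ∀ φ lam → sumℤ (map φ (boxes lam)) ≡
    sumTo (length lam) (λ i → sumTo (part lam (suc i)) (λ j → φ (suc i , suc j)))
  sum-boxes φ lam = begin
    sumℤ (map φ (concatMap row (range1 (length lam))))
      ≡⟨ cong sumℤ (map-concatMap φ row (range1 (length lam))) ⟩
    sumℤ (concatMap (map φ ∘ row) (range1 (length lam)))
      ≡⟨ sumℤ-concatMap (map φ ∘ row) (range1 (length lam)) ⟩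
    sumℤ (map (sumℤ ∘ map φ ∘ row) (range1 (length lam)))
      ≡⟨ cong sumℤ (map-range1 (sumℤ ∘ map φ ∘ row) (length lam)) ⟩
    sumTo (length lam) (λ i → sumℤ (map φ (row (suc i))))
      ≡⟨ sumTo-cong (length lam) (λ i _ → row-sum i) ⟩
    sumTo (length lam) (λ i → sumTo (part lam (suc i)) (λ j → φ (suc i , suc j))) ∎
    where
    row : ℕ → List (ℕ × ℕ)
    row i = map (λ j → (i , j)) (range1 (part lam i))
    row-sum : ∀ i → sumℤ (map φ (row (suc i))) ≡
                    sumTo (part lam (suc i)) (λ j → φ (suc i , suc j))
    row-sum i =
      trans (cong (sumℤ ∘ map φ) (map-range1 (λ j → (suc i , j)) (part lam (suc i))))
            (cong sumℤ (map-applyUpTo (λ j → (suc i , suc j)) φ (part lam (suc i))))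

  -- Every column met by a lower row also meets the top row, so removing the top row lowers both the
  -- column length and the row index by one and leaves the leg unchanged.
  sumTo-hook : ∀ f {lam} → Linked _≥_ lam →
    sumTo (length lam) (λ i → sumTo (part lam (suc i)) (λ j → f (hook lam (suc i) (suc j))))
      ≡ hookSum f lam
  sumTo-hook f {[]} _ = refl
  sumTo-hook f {a ∷ lam} l =
    cong₂ _+_
      (sumTo-cong a (λ j j<a → cong f (first-row j j<a)))
      (trans (sumTo-cong (length lam) (λ i _ → sumTo-cong (part lam (suc i)) (λ j j<λᵢ →
                cong f (later-row i j (ℕ.≤-trans j<λᵢ (part-≤ l i))))))
             (sumTo-hook f (Linked.tail l)))
    where
    leg : ∀ c → + 1 + c - + 1 ≡ c
    leg = solve-∀
    leg-suc : ∀ c i → (+ 1 + c) - (+ 1 + i) ≡ c - i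
    leg-suc = solve-∀
    first-row : ∀ j → j < a → hook (a ∷ lam) 1 (suc j) ≡ rowHook a lam j
    first-row j j<a = cong (λ c → + a - + suc j + c + + 1)
      (trans (cong (λ c → + c - + 1) (conj-∷ lam j<a)) (leg (+ conj lam (suc j))))
    later-row : ∀ i j → j < a → hook (a ∷ lam) (suc (suc i)) (suc j) ≡ hook lam (suc i) (suc j)
    later-row i j j<a = cong (λ c → + part lam (suc i) - + suc j + c + + 1)
      (trans (cong (λ c → + c - + suc (suc i)) (conj-∷ lam j<a))
             (leg-suc (+ conj lam (suc j)) (+ suc i)))

  sum-hooks : ∀ f {lam} → Linked _≥_ lam →
    sumℤ (map (λ b → f (hook lam (proj₁ b) (proj₂ b))) (boxes lam)) ≡ hookSum f lam
  sum-hooks f {lam} l = trans (sum-boxes _ lam) (sumTo-hook f l)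

  -- Removable boxes after adding a top row

  down : ℕ × ℕ → ℕ × ℕ
  down p = suc (proj₁ p) , proj₂ p

  cornerAt : List ℕ → ℕ → List (ℕ × ℕ)
  cornerAt lam i = if suc (part lam (suc i)) ≤ᵇ part lam i then (i , part lam i) ∷ [] else []

  -- Rows are listed in decreasing order, so a corner in the top row comes last, behind the
  -- renumbered old ones.
  removable-∷ : ∀ a lam → removable (a ∷ lam) ≡ map down (removable lam) ++ cornerAt (a ∷ lam) 1
  removable-∷ a lam = begin
    reverse (concatMap (cornerAt (a ∷ lam)) (range1 (suc (length lam))))
      ≡⟨ cong (reverse ∘ concat) (map-range1 (cornerAt (a ∷ lam)) (suc (length lam))) ⟩
    reverse (first ++ concat (applyUpTo (λ i → cornerAt (a ∷ lam) (suc (suc i))) (length lam)))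
      ≡⟨ cong (λ ps → reverse (first ++ concat ps))
              (applyUpTo-cong (length lam) (λ i _ → cornerAt-suc i)) ⟩
    reverse (first ++ concat (applyUpTo (λ i → map down (cornerAt lam (suc i))) (length lam)))
      ≡⟨ cong (λ ps → reverse (first ++ concat ps))
              (map-range1 (map down ∘ cornerAt lam) (length lam)) ⟨
    reverse (first ++ concatMap (map down ∘ cornerAt lam) (range1 (length lam)))
      ≡⟨ cong (λ ps → reverse (first ++ ps))
              (map-concatMap down (cornerAt lam) (range1 (length lam))) ⟨
    reverse (first ++ map down (concatMap (cornerAt lam) (range1 (length lam))))
      ≡⟨ reverse-++ first _ ⟩
    reverse (map down (concatMap (cornerAt lam) (range1 (length lam)))) ++ reverse first
      ≡⟨ cong₂ _++_ (sym (reverse-map down (concatMap (cornerAt lam) (range1 (length lam)))))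
                    reverse-first ⟩
    map down (removable lam) ++ first ∎
    where
    first : List (ℕ × ℕ)
    first = cornerAt (a ∷ lam) 1
    cornerAt-suc : ∀ i → cornerAt (a ∷ lam) (suc (suc i)) ≡ map down (cornerAt lam (suc i))
    -- The conditions agree definitionally, as `part` skips the top row; only `map down` has to move
    -- through the conditional.
    cornerAt-suc i = sym (if-float (map down) (suc (part lam (suc (suc i))) ≤ᵇ part lam (suc i)))
    reverse-first : reverse first ≡ first
    reverse-first with suc (part lam 1) ≤ᵇ a
    ... | true = refl
    ... | false = refl

  -- Σ g(xᵢ) - Σ g(yⱼ) read off a list of corners (α , β), with b in the role of β₀.
  alternating : ℕ → List (ℕ × ℕ) → (ℤ → ℤ) → ℤ
  alternating b [] g = g (+ b - + 0)
  alternating b ((α , β) ∷ ps) g = g (+ b - + α) - g (+ β - + α) + alternating β ps g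

  -- Stated for every `b`, because past the first corner its column takes over the role of β₀.
  sum-alternating : ∀ g b ps →
    sumℤ (map g (zipWith (λ b a → + b - + a) (b ∷ map proj₂ ps) (map proj₁ ps ++ (0 ∷ []))))
      - sumℤ (map g (map (λ p → + proj₂ p - + proj₁ p) ps))
    ≡ alternating b ps g
  sum-alternating g b [] = trans (+-identityʳ _) (+-identityʳ _)
  sum-alternating g b ((α , β) ∷ ps) =
    trans (rearrange (g (+ b - + α)) (g (+ β - + α)) _ _)
          (cong (_+_ (g (+ b - + α) - g (+ β - + α))) (sum-alternating g β ps))
    where
    rearrange : ∀ x y s t → x + s - (y + t) ≡ x - y + (s - t)
    rearrange = solve-∀

  -- Since the closing α is 0, this is also the last x.
  lastColumn : ℕ → List (ℕ × ℕ) → ℕ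
  lastColumn b [] = b
  lastColumn b ((α , β) ∷ ps) = lastColumn β ps

  lastColumn-down : ∀ b ps → lastColumn b (map down ps) ≡ lastColumn b ps
  lastColumn-down b [] = refl
  lastColumn-down b ((α , β) ∷ ps) = lastColumn-down β ps

  lastColumn-∷ʳ : ∀ b ps α β → lastColumn b (ps ++ (α , β) ∷ []) ≡ β
  lastColumn-∷ʳ b [] α β = refl
  lastColumn-∷ʳ b ((_ , β′) ∷ ps) α β = lastColumn-∷ʳ β′ ps α β

  shift : ∀ b α → b - (+ 1 + α) ≡ b - α - + 1
  shift = solve-∀

  -- Moving the corners down lowers every x and y by one except the last x, whose α remains 0. The
  -- two final terms on the right correct for it.
  alternating-down : ∀ b ps g → alternating b (map down ps) g ≡
    alternating b ps (λ u → g (u - + 1)) - g (+ lastColumn b ps - + 1) + g (+ lastColumn b ps)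
  alternating-down b [] g = trans (cong g (minus-0 (+ b))) (trans (insert _ (g (+ b - + 1)))
    (cong (λ x → g (x - + 1) - g (+ b - + 1) + g (+ b)) (sym (minus-0 (+ b)))))
    where
    minus-0 : ∀ x → x - + 0 ≡ x
    minus-0 = solve-∀
    insert : ∀ x y → x ≡ y - y + x
    insert = solve-∀
  alternating-down b ((α , β) ∷ ps) g =
    trans (cong₂ _+_ (cong₂ (λ x y → g x - g y) (shift (+ b) (+ α)) (shift (+ β) (+ α)))
                     (alternating-down β ps g))
          (assoc (g (+ b - + α - + 1) - g (+ β - + α - + 1)) (alternating β ps (λ u → g (u - + 1)))
                 (g (+ lastColumn β ps - + 1)) (g (+ lastColumn β ps)))
    where
    assoc : ∀ x y z w → x + (y - z + w) ≡ x + y - z + w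
    assoc = solve-∀

  -- Here the former last x is lowered as well, because the appended corner replaces the closing α =
  -- 0 by 1; that corner adds the y-value `a - 1` and the new last x-value `a`.
  alternating-down-∷ʳ : ∀ b ps a g → alternating b (map down ps ++ (1 , a) ∷ []) g ≡
    alternating b ps (λ u → g (u - + 1)) - g (+ a - + 1) + g (+ a)
  alternating-down-∷ʳ b [] a g =
    cong₂ (λ x y → g x - g (+ a - + 1) + g y) (shift (+ b) (+ 0)) (+-identityʳ (+ a))
  alternating-down-∷ʳ b ((α , β) ∷ ps) a g =
    trans (cong₂ _+_ (cong₂ (λ x y → g x - g y) (shift (+ b) (+ α)) (shift (+ β) (+ α)))
                     (alternating-down-∷ʳ β ps a g))
          (assoc (g (+ b - + α - + 1) - g (+ β - + α - + 1)) (alternating β ps (λ u → g (u - + 1)))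
                 (g (+ a - + 1)) (g (+ a)))
    where
    assoc : ∀ x y z w → x + (y - z + w) ≡ x + y - z + w
    assoc = solve-∀

  -- The topmost corner ends a row of maximal length. A top row without a corner is as long as the
  -- row below it, and `equal-rows` then recurses to that row.
  lastColumn-removable : ∀ {lam} → Linked _≥_ lam → lastColumn 0 (removable lam) ≡ part lam 1
  equal-rows : ∀ {a lam} → Linked _≥_ (a ∷ lam) → (suc (part lam 1) ≤ᵇ a) ≡ false →
               lastColumn 0 (removable lam) ≡ a

  lastColumn-removable {[]} _ = refl
  lastColumn-removable {a ∷ lam} l =
    trans (cong (lastColumn 0) (removable-∷ a lam)) last
    where
    last : lastColumn 0 (map down (removable lam) ++ cornerAt (a ∷ lam) 1) ≡ a
    last with suc (part lam 1) ≤ᵇ a in eq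
    ... | true = lastColumn-∷ʳ 0 (map down (removable lam)) 1 a
    ... | false = trans (cong (lastColumn 0) (++-identityʳ (map down (removable lam))))
                        (trans (lastColumn-down 0 (removable lam)) (equal-rows l eq))

  equal-rows {a} {lam} l eq =
    trans (lastColumn-removable (Linked.tail l))
          (ℕ.≤∧≮⇒≡ (Linked-head l) (λ λ₁<a → subst T eq (ℕ.≤⇒≤ᵇ λ₁<a)))

  alternating-removable : ∀ {lam} → Linked _≥_ lam → ∀ g →
    alternating 0 (removable lam) g ≡ cornerSum lam g
  alternating-removable {[]} _ g = refl
  alternating-removable {a ∷ lam} l g = begin
    alternating 0 (removable (a ∷ lam)) g
      ≡⟨ cong (λ ps → alternating 0 ps g) (removable-∷ a lam) ⟩
    alternating 0 (map down (removable lam) ++ cornerAt (a ∷ lam) 1) g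
      ≡⟨ step ⟩
    alternating 0 (removable lam) (λ u → g (u - + 1)) - g (+ a - + 1) + g (+ a)
      ≡⟨ cong (λ s → s - g (+ a - + 1) + g (+ a))
              (alternating-removable (Linked.tail l) (λ u → g (u - + 1))) ⟩
    cornerSum (a ∷ lam) g ∎
    where
    -- If the new row equals the one below it, no corner is added, but the
    -- lowered last x contributes the same difference.
    step : alternating 0 (map down (removable lam) ++ cornerAt (a ∷ lam) 1) g ≡
           alternating 0 (removable lam) (λ u → g (u - + 1)) - g (+ a - + 1) + g (+ a)
    step with suc (part lam 1) ≤ᵇ a in eq
    ... | true = alternating-down-∷ʳ 0 (removable lam) a g
    ... | false = begin
      alternating 0 (map down (removable lam) ++ []) g
        ≡⟨ cong (λ ps → alternating 0 ps g) (++-identityʳ (map down (removable lam))) ⟩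
      alternating 0 (map down (removable lam)) g
        ≡⟨ alternating-down 0 (removable lam) g ⟩
      alternating 0 (removable lam) (λ u → g (u - + 1))
        - g (+ lastColumn 0 (removable lam) - + 1) + g (+ lastColumn 0 (removable lam))
        ≡⟨ cong (λ b → alternating 0 (removable lam) (λ u → g (u - + 1)) - g (+ b - + 1) + g (+ b))
                (equal-rows l eq) ⟩
      alternating 0 (removable lam) (λ u → g (u - + 1)) - g (+ a - + 1) + g (+ a) ∎

  q-cornerSum : ∀ k {lam} → Linked _≥_ lam → q k lam ≡ cornerSum lam (_^ k)
  q-cornerSum k {lam} l =
    trans (sum-alternating (_^ k) 0 (removable lam)) (alternating-removable l (_^ k))

-- Polynomials in `u - v` as lists of monomials

module Antidifferences where

  open import Data.Nat as ℕ using (ℕ; zero; suc; _≤_; s≤s; z≤n)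
  import Data.Nat.Properties as ℕ
  open import Data.Integer using (ℤ; +_; -_; _+_; _-_; _*_; _^_)
  open import Data.Integer.Properties
    using (+-assoc; +-identityˡ; *-identityʳ; *-zeroʳ; pos-*)
  open import Data.Integer.Tactic.RingSolver using (solve-∀)
  open import Data.List using (List; []; _∷_; _++_; length; map)
  open import Data.List.Relation.Unary.All as All using (All; []; _∷_)
  open import Data.List.Relation.Unary.All.Properties using (++⁺; map⁺)
  open import Data.Product using (_×_; _,_; proj₁)
  open import Relation.Binary.PropositionalEquality
  open ≡-Reasoning
  open CornerSums using (cornerSum; cornerSum-cong; cornerSum-const; cornerSum-+; cornerSum-*; pairing)

  -- (c , a , b) stands for the monomial c uᵃ vᵇ.
  Term : Set
  Term = ℤ × ℕ × ℕ

  DegreeAtMost : ℕ → Term → Set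
  DegreeAtMost d (_ , a , b) = a ℕ.+ b ≤ d

  eval : List Term → ℤ → ℤ → ℤ
  eval [] u v = + 0
  eval ((c , a , b) ∷ ts) u v = c * (u ^ a * v ^ b) + eval ts u v

  scale : ℤ → List Term → List Term
  scale k = map (λ { (c , a , b) → (k * c , a , b) })

  timesSquareDiff : ℤ → List Term → List Term
  timesSquareDiff s [] = []
  timesSquareDiff s ((c , a , b) ∷ ts) =
    (c , suc (suc a) , b) ∷ (- + 2 * c , suc a , suc b) ∷ (c , a , suc (suc b)) ∷
    (- s * c , a , b) ∷ timesSquareDiff s ts

  eval-++ : ∀ ss ts u v → eval (ss ++ ts) u v ≡ eval ss u v + eval ts u v
  eval-++ [] ts u v = sym (+-identityˡ _)
  eval-++ ((c , a , b) ∷ ss) ts u v =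
    trans (cong (_+_ (c * (u ^ a * v ^ b))) (eval-++ ss ts u v))
          (sym (+-assoc (c * (u ^ a * v ^ b)) (eval ss u v) (eval ts u v)))

  eval-scale : ∀ k ts u v → eval (scale k ts) u v ≡ k * eval ts u v
  eval-scale k [] u v = sym (*-zeroʳ k)
  eval-scale k ((c , a , b) ∷ ts) u v =
    trans (cong (_+_ (k * c * (u ^ a * v ^ b))) (eval-scale k ts u v))
          (factor k c (u ^ a * v ^ b) (eval ts u v))
    where
    factor : ∀ k c m e → k * c * m + k * e ≡ k * (c * m + e)
    factor = solve-∀

  eval-timesSquareDiff : ∀ s ts u v →
    eval (timesSquareDiff s ts) u v ≡ eval ts u v * ((u - v) * (u - v) - s)
  eval-timesSquareDiff s [] u v = refl
  eval-timesSquareDiff s ((c , a , b) ∷ ts) u v =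
    trans (cong (λ e → c * (u * (u * x) * y) + (- + 2 * c * (u * x * (v * y)) +
                       (c * (x * (v * (v * y))) + (- s * c * (x * y) + e))))
                (eval-timesSquareDiff s ts u v))
          (expand s c u v x y (eval ts u v))
    where
    x y : ℤ
    x = u ^ a
    y = v ^ b
    expand : ∀ s c u v x y e →
      c * (u * (u * x) * y) + (- + 2 * c * (u * x * (v * y)) + (c * (x * (v * (v * y))) +
        (- s * c * (x * y) + e * ((u - v) * (u - v) - s))))
      ≡ (c * (x * y) + e) * ((u - v) * (u - v) - s)
    expand = solve-∀

  degree-weaken : ∀ {d e ts} → d ≤ e → All (DegreeAtMost d) ts → All (DegreeAtMost e) ts
  degree-weaken d≤e = All.map (λ t≤d → ℕ.≤-trans t≤d d≤e)

  degree-scale : ∀ {d} k {ts} → All (DegreeAtMost d) ts → All (DegreeAtMost d) (scale k ts)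
  degree-scale k ts≤d = map⁺ ts≤d

  degree-timesSquareDiff : ∀ {d} s {ts} → All (DegreeAtMost d) ts →
                           All (DegreeAtMost (suc (suc d))) (timesSquareDiff s ts)
  degree-timesSquareDiff s [] = []
  degree-timesSquareDiff {d} s {(c , a , b) ∷ ts} (t≤d ∷ ts≤d) =
    s≤s (s≤s t≤d) ∷
    s≤s (subst (_≤ suc d) (sym (ℕ.+-suc a b)) (s≤s t≤d)) ∷
    subst (_≤ suc (suc d)) (sym (trans (ℕ.+-suc a (suc b)) (cong suc (ℕ.+-suc a b)))) (s≤s (s≤s t≤d)) ∷
    ℕ.m≤n⇒m≤1+n (ℕ.m≤n⇒m≤1+n t≤d) ∷
    degree-timesSquareDiff s ts≤d

  -- Central factorials and their second differences

  centralFactorial : ℕ → ℤ → ℤ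
  centralFactorial zero n = + 1
  centralFactorial (suc k) n = centralFactorial k n * (n * n - + k * + k)

  centralFactorialTerms : ℕ → List Term
  centralFactorialTerms zero = (+ 1 , 0 , 0) ∷ []
  centralFactorialTerms (suc k) = timesSquareDiff (+ k * + k) (centralFactorialTerms k)

  centralFactorial-eval : ∀ k u v → centralFactorial k (u - v) ≡ eval (centralFactorialTerms k) u v
  centralFactorial-eval zero u v = refl
  centralFactorial-eval (suc k) u v =
    trans (cong (_* ((u - v) * (u - v) - + k * + k)) (centralFactorial-eval k u v))
          (sym (eval-timesSquareDiff (+ k * + k) (centralFactorialTerms k) u v))

  double-suc : ∀ n → 2 ℕ.* suc n ≡ suc (suc (2 ℕ.* n))
  double-suc n = ℕ.*-suc 2 n

  centralFactorial-degree : ∀ k → All (DegreeAtMost (2 ℕ.* k)) (centralFactorialTerms k)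
  centralFactorial-degree zero = z≤n ∷ []
  centralFactorial-degree (suc k) =
    subst (λ d → All (DegreeAtMost d) (centralFactorialTerms (suc k))) (sym (double-suc k))
          (degree-timesSquareDiff (+ k * + k) (centralFactorial-degree k))

  centralFactorial-zero : ∀ k → centralFactorial (suc k) (+ 0) ≡ + 0
  centralFactorial-zero zero = refl
  centralFactorial-zero (suc k) =
    cong (_* (+ 0 * + 0 - + suc k * + suc k)) (centralFactorial-zero k)

  centralFactorial-even : ∀ k n → centralFactorial k (- n) ≡ centralFactorial k n
  centralFactorial-even zero n = refl
  centralFactorial-even (suc k) n =
    cong₂ (λ x y → x * (y - + k * + k)) (centralFactorial-even k n) (neg-square n)
    where
    neg-square : ∀ n → - n * - n ≡ n * n
    neg-square = solve-∀

  -- The induction for the sum needs the difference as well.  The latter is only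
  -- divisible by (centralFactorial k n) / n, hence the extra factor n.
  centralFactorial-± : ∀ k n →
    (centralFactorial (suc k) (n + + 1) + centralFactorial (suc k) (n - + 1) ≡
      centralFactorial k n * (+ 2 * (n * n - + k * + k) + (+ 2 * + k + + 2) * (+ 2 * + k + + 1)))
    × (n * (centralFactorial (suc k) (n + + 1) - centralFactorial (suc k) (n - + 1)) ≡
      centralFactorial k n * (+ 2 * ((+ 2 * + k + + 2) * (n * n) + + k * + k + + k)))
  centralFactorial-± zero n = plus n , minus n
    where
    plus : ∀ n → + 1 * ((n + + 1) * (n + + 1) - + 0 * + 0) + + 1 * ((n - + 1) * (n - + 1) - + 0 * + 0)
           ≡ + 1 * (+ 2 * (n * n - + 0 * + 0) + (+ 2 * + 0 + + 2) * (+ 2 * + 0 + + 1))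
    plus = solve-∀
    minus : ∀ n → n * (+ 1 * ((n + + 1) * (n + + 1) - + 0 * + 0) - + 1 * ((n - + 1) * (n - + 1) - + 0 * + 0))
            ≡ + 1 * (+ 2 * ((+ 2 * + 0 + + 2) * (n * n) + + 0 * + 0 + + 0))
    minus = solve-∀
  centralFactorial-± (suc k) n with centralFactorial-± k n
  ... | sum≡ , diff≡ =
    -- The new factors at `n + 1` and `n - 1` are `w + 2n` and `w - 2n`, so each of the new sum and
    -- difference is a combination of the old sum and the old difference.
    trans (plus p m n (+ k)) (trans (cong₂ (λ s d → s * w + + 2 * d) sum≡ diff≡) (plus′ c n (+ k))) ,
    trans (minus p m n (+ k))
          (trans (cong₂ (λ s d → d * w + + 2 * (n * n) * s) sum≡ diff≡) (minus′ c n (+ k)))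
    where
    p m c w : ℤ
    p = centralFactorial (suc k) (n + + 1)
    m = centralFactorial (suc k) (n - + 1)
    c = centralFactorial k n
    w = n * n + + 1 - (+ 1 + + k) * (+ 1 + + k)
    plus : ∀ p m n k →
      p * ((n + + 1) * (n + + 1) - (+ 1 + k) * (+ 1 + k)) + m * ((n - + 1) * (n - + 1) - (+ 1 + k) * (+ 1 + k))
      ≡ (p + m) * (n * n + + 1 - (+ 1 + k) * (+ 1 + k)) + + 2 * (n * (p - m))
    plus = solve-∀
    minus : ∀ p m n k →
      n * (p * ((n + + 1) * (n + + 1) - (+ 1 + k) * (+ 1 + k)) - m * ((n - + 1) * (n - + 1) - (+ 1 + k) * (+ 1 + k)))
      ≡ n * (p - m) * (n * n + + 1 - (+ 1 + k) * (+ 1 + k)) + + 2 * (n * n) * (p + m)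
    minus = solve-∀
    plus′ : ∀ c n k →
      c * (+ 2 * (n * n - k * k) + (+ 2 * k + + 2) * (+ 2 * k + + 1)) * (n * n + + 1 - (+ 1 + k) * (+ 1 + k))
        + + 2 * (c * (+ 2 * ((+ 2 * k + + 2) * (n * n) + k * k + k)))
      ≡ c * (n * n - k * k) *
        (+ 2 * (n * n - (+ 1 + k) * (+ 1 + k)) + (+ 2 * (+ 1 + k) + + 2) * (+ 2 * (+ 1 + k) + + 1))
    plus′ = solve-∀
    minus′ : ∀ c n k →
      c * (+ 2 * ((+ 2 * k + + 2) * (n * n) + k * k + k)) * (n * n + + 1 - (+ 1 + k) * (+ 1 + k))
        + + 2 * (n * n) * (c * (+ 2 * (n * n - k * k) + (+ 2 * k + + 2) * (+ 2 * k + + 1)))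
      ≡ c * (n * n - k * k) *
        (+ 2 * ((+ 2 * (+ 1 + k) + + 2) * (n * n) + (+ 1 + k) * (+ 1 + k) + (+ 1 + k)))
    minus′ = solve-∀

  -- Second antidifferences with cleared denominators

  record SecondAntidifference (d : ℕ) (f : ℤ → ℤ) : Set where
    field
      pred-N : ℕ
      P      : ℤ → ℤ
      terms  : List Term
    N : ℤ
    N = + suc pred-N
    field
      P-zero : P (+ 0) ≡ + 0
      P-even : ∀ n → P (- n) ≡ P n
      Δ²P    : ∀ n → P (n + + 1) + P (n - + 1) ≡ + 2 * P n + N * f n
      P-eval : ∀ u v → P (u - v) ≡ eval terms u v
      degree : All (DegreeAtMost d) terms

  open SecondAntidifference

  SecondAntidifference-cong : ∀ {d f g} → (∀ n → f n ≡ g n) →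
                              SecondAntidifference d f → SecondAntidifference d g
  SecondAntidifference-cong f≗g A = record
    { pred-N = pred-N A ; P = P A ; terms = terms A
    ; P-zero = P-zero A ; P-even = P-even A ; P-eval = P-eval A ; degree = degree A
    ; Δ²P = λ n → trans (Δ²P A n) (cong (λ x → + 2 * P A n + N A * x) (f≗g n))
    }

  -- The weights `N B` and `c * N A` bring both antidifferences to the common multiplier
  -- `N A * N B`, so everything stays integral.
  SecondAntidifference-combine : ∀ {d e f g} c → e ≤ d →
    SecondAntidifference d f → SecondAntidifference e g →
    SecondAntidifference d (λ n → f n + c * g n)
  SecondAntidifference-combine {f = f} {g} c e≤d A B = record
    -- Its successor reduces to the product of the two multipliers.
    { pred-N = pred-N B ℕ.+ pred-N A ℕ.* suc (pred-N B)
    ; P = λ n → N B * P A n + c * N A * P B n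
    ; terms = scale (N B) (terms A) ++ scale (c * N A) (terms B)
    ; P-zero = trans (cong₂ (λ x y → N B * x + c * N A * y) (P-zero A) (P-zero B))
                     (vanish (N B) (c * N A))
    ; P-even = λ n → cong₂ (λ x y → N B * x + c * N A * y) (P-even A n) (P-even B n)
    ; Δ²P = λ n → begin
        N B * P A (n + + 1) + c * N A * P B (n + + 1) + (N B * P A (n - + 1) + c * N A * P B (n - + 1))
          ≡⟨ regroup (N B) (c * N A) (P A (n + + 1)) (P B (n + + 1)) (P A (n - + 1)) (P B (n - + 1)) ⟩
        N B * (P A (n + + 1) + P A (n - + 1)) + c * N A * (P B (n + + 1) + P B (n - + 1))
          ≡⟨ cong₂ (λ x y → N B * x + c * N A * y) (Δ²P A n) (Δ²P B n) ⟩
        N B * (+ 2 * P A n + N A * f n) + c * N A * (+ 2 * P B n + N B * g n)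
          ≡⟨ collect c (N A) (N B) (P A n) (P B n) (f n) (g n) ⟩
        + 2 * (N B * P A n + c * N A * P B n) + N A * N B * (f n + c * g n) ∎
    ; P-eval = λ u v → begin
        N B * P A (u - v) + c * N A * P B (u - v)
          ≡⟨ cong₂ (λ x y → N B * x + c * N A * y) (P-eval A u v) (P-eval B u v) ⟩
        N B * eval (terms A) u v + c * N A * eval (terms B) u v
          ≡⟨ cong₂ _+_ (eval-scale (N B) (terms A) u v) (eval-scale (c * N A) (terms B) u v) ⟨
        eval (scale (N B) (terms A)) u v + eval (scale (c * N A) (terms B)) u v
          ≡⟨ eval-++ (scale (N B) (terms A)) (scale (c * N A) (terms B)) u v ⟨
        eval (scale (N B) (terms A) ++ scale (c * N A) (terms B)) u v ∎
    ; degree = ++⁺ (degree-scale (N B) (degree A))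
                   (degree-scale (c * N A) (degree-weaken e≤d (degree B)))
    }
    where
    vanish : ∀ x y → x * + 0 + y * + 0 ≡ + 0
    vanish = solve-∀
    regroup : ∀ x y p q r s → x * p + y * q + (x * r + y * s) ≡ x * (p + r) + y * (q + s)
    regroup = solve-∀
    collect : ∀ c M N p q f g → N * (+ 2 * p + M * f) + c * M * (+ 2 * q + N * g)
              ≡ + 2 * (N * p + c * M * q) + M * N * (f + c * g)
    collect = solve-∀

  centralFactorial-antidifference : ∀ k →
    SecondAntidifference (2 ℕ.* suc k) (centralFactorial k)
  centralFactorial-antidifference k = record
    { pred-N = ℕ.pred ((2 ℕ.* k ℕ.+ 2) ℕ.* (2 ℕ.* k ℕ.+ 1))
    ; P = centralFactorial (suc k)
    ; terms = centralFactorialTerms (suc k)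
    ; P-zero = centralFactorial-zero k
    ; P-even = centralFactorial-even (suc k)
    ; P-eval = centralFactorial-eval (suc k)
    ; degree = centralFactorial-degree (suc k)
    ; Δ²P = λ n → trans (proj₁ (centralFactorial-± k n))
        (trans (distribute (centralFactorial k n) (n * n - + k * + k) _)
               (cong (λ M → + 2 * centralFactorial (suc k) n + M * centralFactorial k n) denominator))
    }
    where
    distribute : ∀ c x M → c * (+ 2 * x + M) ≡ + 2 * (c * x) + M * c
    distribute = solve-∀
    product : (2 ℕ.* k ℕ.+ 2) ℕ.* (2 ℕ.* k ℕ.+ 1) ≡ suc (ℕ.pred ((2 ℕ.* k ℕ.+ 2) ℕ.* (2 ℕ.* k ℕ.+ 1)))
    -- With the constants in front both factors are visibly successors, so the predecessor computes.
    product rewrite ℕ.+-comm (2 ℕ.* k) 2 | ℕ.+-comm (2 ℕ.* k) 1 = refl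
    denominator : (+ 2 * + k + + 2) * (+ 2 * + k + + 1) ≡
                  + suc (ℕ.pred ((2 ℕ.* k ℕ.+ 2) ℕ.* (2 ℕ.* k ℕ.+ 1)))
    denominator = begin
      (+ 2 * + k + + 2) * (+ 2 * + k + + 1)
        ≡⟨ cong (λ x → (x + + 2) * (x + + 1)) (pos-* 2 k) ⟨
      + (2 ℕ.* k ℕ.+ 2) * + (2 ℕ.* k ℕ.+ 1)
        ≡⟨ pos-* (2 ℕ.* k ℕ.+ 2) (2 ℕ.* k ℕ.+ 1) ⟨
      + ((2 ℕ.* k ℕ.+ 2) ℕ.* (2 ℕ.* k ℕ.+ 1))
        ≡⟨ cong +_ product ⟩
      + suc (ℕ.pred ((2 ℕ.* k ℕ.+ 2) ℕ.* (2 ℕ.* k ℕ.+ 1))) ∎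

  -- Interpolates between a plain product (`k = 0`) and a central factorial (empty list), so that a
  -- product can be expanded one factor at a time.
  evenProduct : ℕ → List ℤ → ℤ → ℤ
  evenProduct k ss n = centralFactorial k n * prodℤ (map (λ s → n * n - s) ss)

  -- Each factor is absorbed by n² - s = (n² - k²) + (k² - s).
  evenProduct-antidifference : ∀ k ss →
    SecondAntidifference (2 ℕ.* suc (k ℕ.+ length ss)) (evenProduct k ss)
  evenProduct-antidifference k [] =
    subst (λ l → SecondAntidifference (2 ℕ.* suc l) (evenProduct k [])) (sym (ℕ.+-identityʳ k))
      (SecondAntidifference-cong (λ n → sym (*-identityʳ (centralFactorial k n)))
        (centralFactorial-antidifference k))
  evenProduct-antidifference k (s ∷ ss) =
    SecondAntidifference-cong
      (λ n → absorb (centralFactorial k n) (n * n) (+ k * + k) s (prodℤ (map (λ s → n * n - s) ss)))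
      -- The summand with coefficient k² - s has lost a quadratic factor, so its degree bound is
      -- smaller by two and gets weakened.
      (SecondAntidifference-combine (+ k * + k - s)
        (ℕ.*-monoʳ-≤ 2 (s≤s (ℕ.+-monoʳ-≤ k (ℕ.n≤1+n (length ss)))))
        (subst (λ l → SecondAntidifference (2 ℕ.* suc l) (evenProduct (suc k) ss))
               (sym (ℕ.+-suc k (length ss)))
               (evenProduct-antidifference (suc k) ss))
        (evenProduct-antidifference k ss))
    where
    absorb : ∀ c n² k² s r → c * (n² - k²) * r + (k² - s) * (c * r) ≡ c * ((n² - s) * r)
    absorb = solve-∀

  -- The quadratic form on monomials

  pairing-monomials : List ℕ → List Term → ℤ
  pairing-monomials lam [] = + 0
  pairing-monomials lam ((c , a , b) ∷ ts) =
    c * (cornerSum lam (_^ a) * cornerSum lam (_^ b)) + pairing-monomials lam ts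

  -- By linearity in each variable, uᵃ vᵇ pairs to the product of the corner sums of uᵃ and of vᵇ.
  cornerSum-eval : ∀ lam ts →
    cornerSum lam (λ u → cornerSum lam (λ v → eval ts u v)) ≡ pairing-monomials lam ts
  cornerSum-eval lam [] =
    trans (cornerSum-cong lam (λ _ → cornerSum-const lam (+ 0))) (cornerSum-const lam (+ 0))
  cornerSum-eval lam ((c , a , b) ∷ ts) = begin
    cornerSum lam (λ u → cornerSum lam (λ v → c * (u ^ a * v ^ b) + eval ts u v))
      ≡⟨ cornerSum-cong lam inner ⟩
    cornerSum lam (λ u → c * B * u ^ a + cornerSum lam (λ v → eval ts u v))
      ≡⟨ cornerSum-+ lam (λ u → c * B * u ^ a) _ ⟩
    cornerSum lam (λ u → c * B * u ^ a) + cornerSum lam (λ u → cornerSum lam (λ v → eval ts u v))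
      ≡⟨ cong₂ _+_ (cornerSum-* lam (c * B) (_^ a)) (cornerSum-eval lam ts) ⟩
    c * B * A + pairing-monomials lam ts
      ≡⟨ cong (_+ pairing-monomials lam ts) (swap c B A) ⟩
    c * (A * B) + pairing-monomials lam ts ∎
    where
    A B : ℤ
    A = cornerSum lam (_^ a)
    B = cornerSum lam (_^ b)
    swap : ∀ x y z → x * y * z ≡ x * (z * y)
    swap = solve-∀
    swap′ : ∀ x y z → x * y * z ≡ x * z * y
    swap′ = solve-∀
    assoc : ∀ x y z → x * (y * z) ≡ x * y * z
    assoc = solve-∀
    inner : ∀ u → cornerSum lam (λ v → c * (u ^ a * v ^ b) + eval ts u v) ≡
                  c * B * u ^ a + cornerSum lam (λ v → eval ts u v)
    inner u = begin
      cornerSum lam (λ v → c * (u ^ a * v ^ b) + eval ts u v)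
        ≡⟨ cornerSum-+ lam (λ v → c * (u ^ a * v ^ b)) _ ⟩
      cornerSum lam (λ v → c * (u ^ a * v ^ b)) + cornerSum lam (λ v → eval ts u v)
        ≡⟨ cong (_+ _) (cornerSum-cong lam (λ v → assoc c (u ^ a) (v ^ b))) ⟩
      cornerSum lam (λ v → c * u ^ a * v ^ b) + cornerSum lam (λ v → eval ts u v)
        ≡⟨ cong (_+ _) (trans (cornerSum-* lam (c * u ^ a) (_^ b)) (swap′ c (u ^ a) B)) ⟩
      c * B * u ^ a + cornerSum lam (λ v → eval ts u v) ∎

  pairing-eval : ∀ {d f} (A : SecondAntidifference d f) lam →
                 pairing (P A) lam ≡ pairing-monomials lam (terms A)
  pairing-eval A lam =
    trans (cornerSum-cong lam (λ u → cornerSum-cong lam (λ v → P-eval A u v)))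
          (cornerSum-eval lam (terms A))

-- The hook polynomial and the partitions indexing its expansion

module HookPolynomials where

  open import Data.Nat as ℕ using (ℕ; zero; suc; _≤_; _≥_; z≤n; s≤s)
  import Data.Nat.Properties as ℕ
  open import Data.Integer using (ℤ; +_; _+_; _-_; _*_; _^_)
  open import Data.Integer.Properties using (*-identityˡ; *-identityʳ; *-comm)
  open import Data.Rational as ℚ using (ℚ; _/_; 0ℚ; toℚᵘ)
  import Data.Rational.Properties as ℚ
  open import Data.Rational.Unnormalised as ℚᵘ using (mkℚᵘ; *≡*; _≃_)
  import Data.Rational.Unnormalised.Properties as ℚᵘ
  open import Data.Integer.Tactic.RingSolver using (solve-∀)
  open import Data.List using (List; []; _∷_; foldr; length; map)
  open import Data.List.Properties using (map-cong; map-∘; length-map; length-applyUpTo)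
  open import Data.List.Relation.Unary.All as All using (All; []; _∷_)
  open import Data.List.Relation.Unary.All.Properties using (map⁺)
  open import Data.List.Relation.Unary.Linked using (Linked; []; [-]; _∷_)
  open import Data.Product using (_×_; _,_; proj₁; proj₂)
  open import Data.Sum using (inj₁; inj₂)
  open import Relation.Binary.PropositionalEquality
  open CornerSums
  open Corners
  open Antidifferences

  hookPolynomial : ℕ → ℤ → ℤ
  hookPolynomial r h = prodℤ (map (λ j → h ^ 2 - (+ j) ^ 2) (range1 r))

  length-range1 : ∀ r → length (range1 r) ≡ r
  length-range1 r = trans (cong length (range1-applyUpTo r)) (length-applyUpTo suc r)

  -- Starting at `k = 0` the central factorial is 1 and all factors sit in the list 1², ..., r²,
  -- whose length `r` yields the degree 2r + 2.
  hookPolynomial-antidifference : ∀ r → SecondAntidifference (2 ℕ.* r ℕ.+ 2) (hookPolynomial r)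
  hookPolynomial-antidifference r =
    SecondAntidifference-cong evenProduct≗
      (subst (λ d → SecondAntidifference d (evenProduct 0 squares)) degree≡
             (evenProduct-antidifference 0 squares))
    where
    squares : List ℤ
    squares = map (λ j → + j * + j) (range1 r)
    degree≡ : 2 ℕ.* suc (length squares) ≡ 2 ℕ.* r ℕ.+ 2
    degree≡ = trans (cong (λ l → 2 ℕ.* suc l) (trans (length-map _ (range1 r)) (length-range1 r)))
                    (trans (ℕ.*-suc 2 r) (ℕ.+-comm 2 (2 ℕ.* r)))
    square : ∀ n → n ^ 2 ≡ n * n
    square n = cong (n *_) (*-identityʳ n)
    evenProduct≗ : ∀ n → evenProduct 0 squares n ≡ hookPolynomial r n
    evenProduct≗ n = trans (*-identityˡ _) (cong prodℤ
      (trans (sym (map-∘ (range1 r)))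
             (map-cong (λ j → cong₂ _-_ (sym (square n)) (sym (square (+ j)))) (range1 r))))

  -- The index of q_a q_b: exponents 0 are dropped, as q₀ = 1 and parts are positive, and the rest
  -- is sorted into decreasing order.
  pairPartition : ℕ → ℕ → List ℕ
  pairPartition zero zero = []
  pairPartition zero (suc b) = suc b ∷ []
  pairPartition (suc a) zero = suc a ∷ []
  pairPartition (suc a) (suc b) with ℕ.≤-total a b
  ... | inj₁ _ = suc b ∷ suc a ∷ []
  ... | inj₂ _ = suc a ∷ suc b ∷ []

  pairPartition-isPartition : ∀ a b → IsPartition (pairPartition a b)
  pairPartition-isPartition zero zero = [] , []
  pairPartition-isPartition zero (suc b) = s≤s z≤n ∷ [] , [-]
  pairPartition-isPartition (suc a) zero = s≤s z≤n ∷ [] , [-]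
  pairPartition-isPartition (suc a) (suc b) with ℕ.≤-total a b
  ... | inj₁ a≤b = s≤s z≤n ∷ s≤s z≤n ∷ [] , s≤s a≤b ∷ [-]
  ... | inj₂ b≤a = s≤s z≤n ∷ s≤s z≤n ∷ [] , s≤s b≤a ∷ [-]

  pairPartition-size : ∀ a b → size (pairPartition a b) ≡ a ℕ.+ b
  pairPartition-size zero zero = refl
  pairPartition-size zero (suc b) = ℕ.+-identityʳ (suc b)
  pairPartition-size (suc a) zero = refl
  pairPartition-size (suc a) (suc b) with ℕ.≤-total a b
  ... | inj₁ _ = trans (cong (suc b ℕ.+_) (ℕ.+-identityʳ (suc a))) (ℕ.+-comm (suc b) (suc a))
  ... | inj₂ _ = cong (suc a ℕ.+_) (ℕ.+-identityʳ (suc b))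

  qν-pairPartition : ∀ a b {lam} → Linked _≥_ lam →
    qν (pairPartition a b) lam ≡ cornerSum lam (_^ a) * cornerSum lam (_^ b)
  qν-pairPartition zero zero {lam} l
    rewrite cornerSum-const lam (+ 1) = refl
  qν-pairPartition zero (suc b) {lam} l
    rewrite cornerSum-const lam (+ 1) | q-cornerSum (suc b) l = *-comm _ (+ 1)
  qν-pairPartition (suc a) zero {lam} l
    rewrite cornerSum-const lam (+ 1) | q-cornerSum (suc a) l = refl
  qν-pairPartition (suc a) (suc b) {lam} l with ℕ.≤-total a b
  ... | inj₁ _ rewrite q-cornerSum (suc a) l | q-cornerSum (suc b) l =
    trans (cong (_*_ B) (*-identityʳ A)) (*-comm B A)
    where
    A B : ℤ
    A = cornerSum lam (_^ suc a)
    B = cornerSum lam (_^ suc b)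
  ... | inj₂ _ rewrite q-cornerSum (suc a) l | q-cornerSum (suc b) l =
    cong (_*_ (cornerSum lam (_^ suc a))) (*-identityʳ _)

  -- Rational coefficients over a common denominator

  toℚᵘ-/ : ∀ n d-1 → toℚᵘ (n / suc d-1) ≃ mkℚᵘ n d-1
  toℚᵘ-/ n d-1 = ℚ.toℚᵘ-fromℚᵘ (mkℚᵘ n d-1)

  -- `_/_` cancels common factors, so the comparison passes through unnormalised fractions, where it
  -- becomes an identity of integers.
  /-*-/1 : ∀ c x d-1 → (c / suc d-1) ℚ.* (x / 1) ≡ (c * x) / suc d-1
  /-*-/1 c x d-1 = ℚ.toℚᵘ-injective (begin
    toℚᵘ ((c / suc d-1) ℚ.* (x / 1))        ≈⟨ ℚ.toℚᵘ-homo-* (c / suc d-1) (x / 1) ⟩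
    toℚᵘ (c / suc d-1) ℚᵘ.* toℚᵘ (x / 1)    ≈⟨ ℚᵘ.*-cong (toℚᵘ-/ c d-1) (toℚᵘ-/ x 0) ⟩
    mkℚᵘ c d-1 ℚᵘ.* mkℚᵘ x 0                ≈⟨ *≡* (cong (λ e → c * x * + e) (sym (ℕ.*-identityʳ (suc d-1)))) ⟩
    mkℚᵘ (c * x) d-1                        ≈⟨ toℚᵘ-/ (c * x) d-1 ⟨
    toℚᵘ ((c * x) / suc d-1)                ∎)
    where open ℚᵘ.≃-Reasoning

  /-+-/ : ∀ x y d-1 → (x / suc d-1) ℚ.+ (y / suc d-1) ≡ (x + y) / suc d-1
  /-+-/ x y d-1 = ℚ.toℚᵘ-injective (begin
    toℚᵘ ((x / suc d-1) ℚ.+ (y / suc d-1))      ≈⟨ ℚ.toℚᵘ-homo-+ (x / suc d-1) (y / suc d-1) ⟩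
    toℚᵘ (x / suc d-1) ℚᵘ.+ toℚᵘ (y / suc d-1)  ≈⟨ ℚᵘ.+-cong (toℚᵘ-/ x d-1) (toℚᵘ-/ y d-1) ⟩
    mkℚᵘ x d-1 ℚᵘ.+ mkℚᵘ y d-1                  ≈⟨ *≡* (factor x y (+ suc d-1)) ⟩
    mkℚᵘ (x + y) d-1                            ≈⟨ toℚᵘ-/ (x + y) d-1 ⟨
    toℚᵘ ((x + y) / suc d-1)                    ∎)
    where
    open ℚᵘ.≃-Reasoning
    factor : ∀ x y d → (x * d + y * d) * d ≡ (x + y) * (d * d)
    factor = solve-∀

  */-cancel : ∀ x d-1 → (+ suc d-1 * x) / suc d-1 ≡ x / 1
  */-cancel x d-1 = ℚ.fromℚᵘ-cong {mkℚᵘ (+ suc d-1 * x) d-1} {mkℚᵘ x 0}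
    (*≡* (trans (*-identityʳ (+ suc d-1 * x)) (*-comm (+ suc d-1) x)))

  -- Monomials such as uᵃ vᵇ and uᵇ vᵃ yield the same partition and are not merged: b_ν is the sum
  -- of the coefficients listed with ν.
  toPair : ℕ → Term → List ℕ × ℚ
  toPair d-1 (c , a , b) = pairPartition a b , c / suc d-1

  toPair-degree : ∀ d-1 {d ts} → All (DegreeAtMost d) ts →
    All (λ p → IsPartition (proj₁ p) × size (proj₁ p) ≤ d) (map (toPair d-1) ts)
  toPair-degree d-1 ts≤d = map⁺ (All.map (λ { {_ , a , b} a+b≤d →
    pairPartition-isPartition a b , subst (_≤ _) (sym (pairPartition-size a b)) a+b≤d }) ts≤d)

  toPair-sum : ∀ d-1 {lam} → Linked _≥_ lam → ∀ ts →
    foldr ℚ._+_ 0ℚ (map (λ p → proj₂ p ℚ.* (qν (proj₁ p) lam / 1)) (map (toPair d-1) ts))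
      ≡ pairing-monomials lam ts / suc d-1
  toPair-sum d-1 l [] = sym (ℚ.fromℚᵘ-cong {mkℚᵘ (+ 0) d-1} {mkℚᵘ (+ 0) 0} (*≡* refl))
  toPair-sum d-1 {lam} l ((c , a , b) ∷ ts) =
    trans (cong₂ ℚ._+_
            (trans (/-*-/1 c (qν (pairPartition a b) lam) d-1)
                   (cong (λ x → (c * x) / suc d-1) (qν-pairPartition a b l)))
            (toPair-sum d-1 l ts))
          (/-+-/ (c * (cornerSum lam (_^ a) * cornerSum lam (_^ b))) (pairing-monomials lam ts) d-1)

  S-pairing-monomials : ∀ r {lam} → Linked _≥_ lam →
    let A = hookPolynomial-antidifference r in
    + 2 * SecondAntidifference.N A * S lam r ≡ pairing-monomials lam (SecondAntidifference.terms A)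
  S-pairing-monomials r {lam} l =
    trans (cong (_*_ (+ 2 * N)) (sum-hooks (hookPolynomial r) l))
          (trans (hookSum-pairing N (hookPolynomial r) P P-zero P-even Δ²P l)
                 (pairing-eval (hookPolynomial-antidifference r) lam))
    where open SecondAntidifference (hookPolynomial-antidifference r)

open import Data.Nat using (ℕ; suc; _≤_; _+_; _*_)
open import Data.Rational using (ℚ; _/_)
open import Data.List using (List; map; foldr)
open import Data.List.Relation.Unary.All using (All)
open import Data.Product using (Σ; _×_; _,_; proj₁; proj₂)
open import Relation.Binary.PropositionalEquality using (_≡_; cong; sym; trans)
open HookPolynomials
open Antidifferences using (module SecondAntidifference)

theorem7p1 : (r : ℕ) →
    Σ (List (List ℕ × ℚ)) λ bs →
    All (λ p → IsPartition (proj₁ p) × size (proj₁ p) ≤ 2 * r + 2) bs ×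
    ((lam : List ℕ) → IsPartition lam →
    (S lam r / 1) ≡ foldr Data.Rational._+_ (Data.Rational.0ℚ)
    (map (λ p → proj₂ p Data.Rational.* (qν (proj₁ p) lam / 1)) bs))
theorem7p1 r =
  -- The successor of `pred-N + 1 * suc pred-N` is what `2 * suc pred-N` reduces to, so the common
  -- denominator is 2N. The list is fixed before `lam` is introduced.
  map (toPair (pred-N + 1 * suc pred-N)) terms ,
  toPair-degree (pred-N + 1 * suc pred-N) degree ,
  λ lam (_ , l) →
    trans (sym (*/-cancel (S lam r) (pred-N + 1 * suc pred-N)))
          (trans (cong (_/ (2 * suc pred-N)) (S-pairing-monomials r l))
                 (sym (toPair-sum (pred-N + 1 * suc pred-N) l terms)))
  where
  open SecondAntidifference (hookPolynomial-antidifference r)
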